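{- Let $k_1,k_2,k_3$ be positive integers and $\vec{k}=(k_1,k_2,k_3)$. Then the $q,t$-Catalan number $C_{\vec{k}}(q,t)$ is $q,t$-symmetric, i.e. $C_{\vec{k}}(q,t)=C_{\vec{k}}(t,q)$ as polynomials in $q,t$.
   Context: For a vector $\vec{k}=(k_1,k_2,k_3)$ of positive integers, a $\vec{k}$-Dyck path is a lattice path starting and ending at level $0$ and never going below level $0$, consisting of three red up steps of heights $k_1,k_2,k_3$ (in this order, the first being the first step of the path) and $k_1+k_2+k_3$ blue down steps of height $1$. The red ranks $(r_1,r_2,r_3)$ of the path are the levels at which the three red steps start, so $r_1=0$. The set $\mathcal{D}_{\vec{k}}$ of $\vec{k}$-Dyck paths is in bijection, via red ranks, with the set of integer pairs $(r_2,r_3)$ such that $0\le r_2\le k_1$ and $0\le r_3\le r_2+k_2$. For $D\in\mathcal{D}_{\vec{k}}$ with red ranks $(0,r_2,r_3)$, the statistics area and bounce are $$\mathrm{area}(D)=r_2+r_3,$$ $$\mathrm{bounce}(D)=\begin{cases}2(k_1-r_2)+r_2+k_2-r_3-\min(r_2,k_2), & \text{if } r_2+k_2-r_3\ge 2\min(r_2,k_2),\\[2pt] 2(k_1-r_2)+\left\lceil \frac{r_2+k_2-r_3}{2}\right\rceil, & \text{otherwise.}\end{cases}$$ The generalized $q,t$-Catalan number is $$C_{\vec{k}}(q,t)=\sum_{D\in\mathcal{D}_{\vec{k}}}q^{\mathrm{area}(D)}t^{\mathrm{bounce}(D)}.$$ -}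

module Defs where

open import Data.Bool using (if_then_else_)
open import Data.List using (List; []; _∷_; _++_; map; foldr; cartesianProductWith)
open import Data.List.Membership.Propositional using (_∈_)
open import Data.List.Membership.Propositional.Properties using (∈-map⁺; ∈-map⁻; ∈-++⁺ˡ; ∈-++⁺ʳ)
open import Data.List.Relation.Unary.All using ([])
open import Data.List.Relation.Unary.Any using (here)
open import Data.List.Relation.Unary.AllPairs using ([]; _∷_)
open import Data.List.Relation.Unary.Unique.Propositional using (Unique)
import Data.List.Relation.Unary.Unique.Propositional.Properties as Uniqueₚ
open import Data.Nat using (ℕ; zero; suc; _+_; _*_; _∸_; _⊓_; _≤?_; _≟_; ⌈_/2⌉)
open import Data.Product using (_×_; _,_)
open import Data.Product.Properties using (≡-dec)
open import Data.Vec using (Vec; []; _∷_)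
open import Function using (case_of_)
open import Relation.Binary.PropositionalEquality using (_≡_; refl)
open import Relation.Nullary using (does)

private
  variable
    n h k : ℕ
    ks : Vec ℕ n

-- Path ks h: lattice paths from level h to level 0 whose up (red) steps have
-- heights ks in this order, the down (blue) steps having height 1. Levels are
-- natural numbers, so the path never goes below 0. When h = 0, the first step
-- (if any) is necessarily red and the number of blue steps is the sum of ks.
data Path : Vec ℕ n → ℕ → Set where
  end  : Path [] 0
  red  : Path ks (h + k) → Path (k ∷ ks) h
  blue : Path ks h → Path ks (suc h)

DyckPath : Vec ℕ n → Set
DyckPath ks = Path ks 0

redRanks : {ks : Vec ℕ n} → Path ks h → Vec ℕ n
redRanks end             = []
redRanks {h = h} (red p) = h ∷ redRanks p
redRanks (blue p)        = redRanks p

paths : (ks : Vec ℕ n) (h : ℕ) → List (Path ks h)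
paths []       zero    = end ∷ []
paths []       (suc h) = map blue (paths [] h)
paths (k ∷ ks) zero    = map red (paths ks k)
paths (k ∷ ks) (suc h) = map red (paths ks (suc h + k)) ++ map blue (paths (k ∷ ks) h)

paths-complete : (p : Path ks h) → p ∈ paths ks h
paths-complete end                                = here refl
paths-complete {h = zero}  (red p)                = ∈-map⁺ red (paths-complete p)
paths-complete {h = suc h} (red p)                = ∈-++⁺ˡ (∈-map⁺ red (paths-complete p))
paths-complete {ks = []} (blue p)                 = ∈-map⁺ blue (paths-complete p)
paths-complete {ks = k ∷ ks} {h = suc h} (blue p) =
  ∈-++⁺ʳ (map red (paths ks (suc h + k))) (∈-map⁺ blue (paths-complete p))

paths-unique : (ks : Vec ℕ n) (h : ℕ) → Unique (paths ks h)
paths-unique []       zero    = [] ∷ []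
paths-unique []       (suc h) = Uniqueₚ.map⁺ (λ { refl → refl }) (paths-unique [] h)
paths-unique (k ∷ ks) zero    = Uniqueₚ.map⁺ (λ { refl → refl }) (paths-unique ks k)
paths-unique (k ∷ ks) (suc h) = Uniqueₚ.++⁺
  (Uniqueₚ.map⁺ (λ { refl → refl }) (paths-unique ks (suc h + k)))
  (Uniqueₚ.map⁺ (λ { refl → refl }) (paths-unique (k ∷ ks) h))
  λ { (x∈reds , x∈blues) → case ∈-map⁻ red x∈reds , ∈-map⁻ blue x∈blues of
    λ { ((_ , _ , refl) , (_ , _ , ())) } }

dyckPaths : (ks : Vec ℕ n) → List (DyckPath ks)
dyckPaths ks = paths ks 0

area : {ks : Vec ℕ 3} → DyckPath ks → ℕ
area D with redRanks D
... | _ ∷ r₂ ∷ r₃ ∷ [] = r₂ + r₃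

-- Red ranks satisfy r₂ ≤ k₁ and r₃ ≤ r₂ + k₂, and the first case has
-- m ≤ 2 * m ≤ d, so no subtraction below is truncated.
bounce : {ks : Vec ℕ 3} → DyckPath ks → ℕ
bounce {k₁ ∷ k₂ ∷ _ ∷ []} D with redRanks D
... | _ ∷ r₂ ∷ r₃ ∷ [] =
  if does (2 * m ≤? d)
  then 2 * (k₁ ∸ r₂) + (d ∸ m)
  else 2 * (k₁ ∸ r₂) + ⌈ d /2⌉
  where
  m = r₂ ⊓ k₂
  d = r₂ + k₂ ∸ r₃

-- ℕ[q,t]: a polynomial is presented by a list of terms (c , i , j), standing
-- for c qⁱ tʲ, with repetitions allowed; equality compares coefficients.
Poly : Set
Poly = List (ℕ × ℕ × ℕ)

coeff : Poly → ℕ × ℕ → ℕ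
coeff []            m  = 0
coeff ((c , m′) ∷ f) m = (if does (≡-dec _≟_ _≟_ m′ m) then c else 0) + coeff f m

infix  4 _≈_
infixl 6 _⊕_
infixl 7 _⊗_
infixr 8 _↑_

_≈_ : Poly → Poly → Set
f ≈ g = ∀ m → coeff f m ≡ coeff g m

𝟘 𝟙 q t : Poly
𝟘 = []
𝟙 = (1 , 0 , 0) ∷ []
q = (1 , 1 , 0) ∷ []
t = (1 , 0 , 1) ∷ []

_⊕_ _⊗_ : Poly → Poly → Poly
_⊕_ = _++_
_⊗_ = cartesianProductWith λ { (c , i , j) (c′ , i′ , j′) → (c * c′ , i + i′ , j + j′) }

_↑_ : Poly → ℕ → Poly
f ↑ zero  = 𝟙
f ↑ suc n = f ⊗ f ↑ n

sumPoly : List Poly → Poly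
sumPoly = foldr _⊕_ 𝟘

C : Vec ℕ 3 → Poly → Poly → Poly
C ks x y = sumPoly (map (λ D → x ↑ area D ⊗ y ↑ bounce D) (dyckPaths ks))

{-# OPTIONS --safe #-}

-- With (a , b) = (k₁ , k₂) and (r , s) = (r₂ , r₃), put d = r + b − s and
-- e = min(r, b, ⌊d/2⌋). Both cases of the definition of bounce say that
-- area + bounce + e = 2a + b. Among the pairs with a fixed e < b each area A
-- occurs at most once, namely at r = e + ⌈(A ∸ b)/2⌉, and if e ≤ a it does so
-- exactly when e ≤ A and 2e + A ≤ 2a + b, i.e. when e ≤ area and e ≤ bounce, a
-- condition symmetric in area and bounce. The pairs with e = b are those with
-- s + b ≤ r, where area + bounce = 2a and (r , s) ↦ (a − s , a − r) exchanges
-- the two statistics. Together this gives an involution on the valid pairs.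
module Submission where

open import Defs
open import Data.Bool using (if_then_else_)
open import Data.List using (List; []; _∷_; _++_; map; [_])
open import Data.List.Membership.Propositional using (_∈_)
open import Data.List.Membership.Propositional.Properties using (∈-map⁺; ∈-map⁻)
open import Data.List.Membership.Propositional.Properties.WithK using (unique∧set⇒bag)
open import Data.List.Properties using (map-∘; map-cong-local; map-id)
open import Data.List.Relation.Binary.BagAndSetEquality using (∼bag⇒↭)
open import Data.List.Relation.Binary.Permutation.Propositional using (_↭_; prep; swap)
open import Data.List.Relation.Binary.Permutation.Propositional.Properties using (map⁺)
import Data.List.Relation.Unary.All as All
open import Data.List.Relation.Unary.Unique.Propositional using (Unique)
import Data.List.Relation.Unary.Unique.Propositional.Properties as Uniqueₚ
open import Data.Nat
open import Data.Nat.Properties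
open import Data.Nat.Tactic.RingSolver using (solve-∀)
open import Data.Product using (_×_; _,_; proj₁; proj₂; ∃-syntax; Σ-syntax)
open import Data.Product.Properties using (≡-dec)
open import Data.Sum using (inj₁; inj₂)
open import Data.Vec using (Vec; []; _∷_)
open import Data.Vec.Properties using (∷-injectiveˡ; ∷-injectiveʳ)
open import Function using (_∘_; mk⇔)
open import Relation.Binary.PropositionalEquality
  using (_≡_; _≢_; refl; sym; trans; cong; cong₂; subst; module ≡-Reasoning)
open import Relation.Nullary using (¬_; Dec; does; yes; no; contradiction)

-- Rounded halves of natural numbers.

⌊m/2⌋+⌈n/2⌉≡o : ∀ m {n o} → m + n ≡ o + o → ⌊ m /2⌋ + ⌈ n /2⌉ ≡ o
⌊m/2⌋+⌈n/2⌉≡o zero {o = o} eq = trans (cong ⌈_/2⌉ eq) (sym (n≡⌈n+n/2⌉ o))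
⌊m/2⌋+⌈n/2⌉≡o (suc zero) {o = suc o} eq =
  trans (cong ⌊_/2⌋ (trans eq (cong suc (+-suc o o)))) (cong suc (sym (n≡⌊n+n/2⌋ o)))
⌊m/2⌋+⌈n/2⌉≡o (suc (suc m)) {o = suc o} eq =
  cong suc (⌊m/2⌋+⌈n/2⌉≡o m (suc-injective (trans (suc-injective eq) (+-suc o o))))

⌈m+m+n/2⌉≡m+⌈n/2⌉ : ∀ m n → ⌈ m + m + n /2⌉ ≡ m + ⌈ n /2⌉
⌈m+m+n/2⌉≡m+⌈n/2⌉ zero    n = refl
⌈m+m+n/2⌉≡m+⌈n/2⌉ (suc m) n =
  trans (cong (λ x → ⌈ suc (x + n) /2⌉) (+-suc m m)) (cong suc (⌈m+m+n/2⌉≡m+⌈n/2⌉ m n))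

m+m≤n⇒m≤⌊n/2⌋ : ∀ {m n} → m + m ≤ n → m ≤ ⌊ n /2⌋
m+m≤n⇒m≤⌊n/2⌋ {m} m+m≤n = ≤-trans (≤-reflexive (n≡⌊n+n/2⌋ m)) (⌊n/2⌋-mono m+m≤n)

m≤⌊n/2⌋⇒m+m≤n : ∀ {m} n → m ≤ ⌊ n /2⌋ → m + m ≤ n
m≤⌊n/2⌋⇒m+m≤n n m≤ =
  ≤-trans (+-mono-≤ m≤ (≤-trans m≤ (⌊n/2⌋≤⌈n/2⌉ n))) (≤-reflexive (⌊n/2⌋+⌈n/2⌉≡n n))

n≤⌈n/2⌉+⌈n/2⌉ : ∀ n → n ≤ ⌈ n /2⌉ + ⌈ n /2⌉
n≤⌈n/2⌉+⌈n/2⌉ n =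
  ≤-trans (≤-reflexive (sym (⌊n/2⌋+⌈n/2⌉≡n n))) (+-monoˡ-≤ ⌈ n /2⌉ (⌊n/2⌋≤⌈n/2⌉ n))

-- Passing the decision as an argument avoids a `with`, which would have to find it in a goal where
-- `does` may already have computed.
if-elim : ∀ {A P : Set} (Q : A → Set) (p? : Dec P) {x y : A} →
  (P → Q x) → (¬ P → Q y) → Q (if does p? then x else y)
if-elim Q (yes p) f g = f p
if-elim Q (no ¬p) f g = g ¬p

-- Rank pairs, their statistics and the defect.

Ranks : Set
Ranks = ℕ × ℕ

Valid : ℕ → ℕ → Ranks → Set
Valid a b (r , s) = r ≤ a × s ≤ r + b

rankArea : Ranks → ℕ
rankArea (r , s) = r + s

rankBounce : ℕ → ℕ → Ranks → ℕ
rankBounce a b (r , s) =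
  if does (2 * (r ⊓ b) ≤? r + b ∸ s)
  then 2 * (a ∸ r) + (r + b ∸ s ∸ r ⊓ b)
  else 2 * (a ∸ r) + ⌈ r + b ∸ s /2⌉

defect : ℕ → Ranks → ℕ
defect b (r , s) = r ⊓ b ⊓ ⌊ r + b ∸ s /2⌋

-- The test `2 * m ≤ d` amounts to `m ≤ ⌊ d /2⌋`. So bounce removes from `d` the amount `m` in one
-- case and `⌊ d /2⌋` in the other, each time the smaller of the two, which is the defect.
area+bounce+defect : ∀ a b {x} → Valid a b x →
  rankArea x + rankBounce a b x + defect b x ≡ a + a + b
area+bounce+defect a b {r , s} (r≤a , s≤r+b) =
  if-elim (λ f → r + s + f + defect b (r , s) ≡ a + a + b) (2 * m ≤? d) short long
  where
  m = r ⊓ b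
  d = r + b ∸ s

  -- In both branches `f` is what the defect leaves of `d`. Then `s + d` is `r + b`, and
  -- `2 * (a ∸ r)` completes `r + r` to `a + a`.
  balance : ∀ {f e} → f + e ≡ d → r + s + (2 * (a ∸ r) + f) + e ≡ a + a + b
  balance {f} {e} f+e≡d = begin
    r + s + (2 * (a ∸ r) + f) + e   ≡⟨ rearrange₁ r s (a ∸ r) f e ⟩
    r + 2 * (a ∸ r) + (s + (f + e)) ≡⟨ cong (λ x → r + 2 * (a ∸ r) + (s + x)) f+e≡d ⟩
    r + 2 * (a ∸ r) + (s + d)       ≡⟨ cong (r + 2 * (a ∸ r) +_) (m+[n∸m]≡n s≤r+b) ⟩
    r + 2 * (a ∸ r) + (r + b)       ≡⟨ rearrange₂ r (a ∸ r) b ⟩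
    (r + (a ∸ r)) + (r + (a ∸ r)) + b ≡⟨ cong (λ x → x + x + b) (m+[n∸m]≡n r≤a) ⟩
    a + a + b                       ∎
    where
    open ≡-Reasoning
    rearrange₁ : ∀ r s v f e → r + s + (2 * v + f) + e ≡ r + 2 * v + (s + (f + e))
    rearrange₁ = solve-∀
    rearrange₂ : ∀ r v b → r + 2 * v + (r + b) ≡ (r + v) + (r + v) + b
    rearrange₂ = solve-∀

  short : 2 * m ≤ d → r + s + (2 * (a ∸ r) + (d ∸ m)) + defect b (r , s) ≡ a + a + b
  short 2m≤d = balance (trans (cong (d ∸ m +_) (m≤n⇒m⊓n≡m (m+m≤n⇒m≤⌊n/2⌋ m+m≤d)))
                              (m∸n+n≡m (m+n≤o⇒m≤o m m+m≤d)))
    where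
    m+m≤d : m + m ≤ d
    m+m≤d = subst (_≤ d) (cong (m +_) (+-identityʳ m)) 2m≤d
  long : ¬ (2 * m ≤ d) → r + s + (2 * (a ∸ r) + ⌈ d /2⌉) + defect b (r , s) ≡ a + a + b
  long 2m≰d = balance (trans (cong (⌈ d /2⌉ +_) (m≥n⇒m⊓n≡n (<⇒≤ (≰⇒> m≰⌊d/2⌋))))
                             (trans (+-comm ⌈ d /2⌉ ⌊ d /2⌋) (⌊n/2⌋+⌈n/2⌉≡n d)))
    where
    m≰⌊d/2⌋ : ¬ (m ≤ ⌊ d /2⌋)
    m≰⌊d/2⌋ m≤ = 2m≰d (subst (_≤ d) (cong (m +_) (sym (+-identityʳ m))) (m≤⌊n/2⌋⇒m+m≤n d m≤))

-- The half `⌊ r + b ∸ s /2⌋` is then at least `b`, so `b + b ≤ r + b ∸ s`.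
b≤defect⇒far : ∀ {b r s} → s ≤ r + b → b ≤ defect b (r , s) → s + b ≤ r
b≤defect⇒far {b} {r} {s} s≤r+b b≤e = +-cancelʳ-≤ b (s + b) r (begin
  s + b + b           ≡⟨ +-assoc s b b ⟩
  s + (b + b)         ≤⟨ +-monoʳ-≤ s (m≤⌊n/2⌋⇒m+m≤n (r + b ∸ s) (≤-trans b≤e (m⊓n≤n _ _))) ⟩
  s + (r + b ∸ s)     ≡⟨ m+[n∸m]≡n s≤r+b ⟩
  r + b               ∎)
  where open ≤-Reasoning

far⇒defect≡b : ∀ {b r s} → s + b ≤ r → defect b (r , s) ≡ b
far⇒defect≡b {b} {r} {s} far =
  trans (cong (_⊓ ⌊ r + b ∸ s /2⌋) (m≥n⇒m⊓n≡n (m+n≤o⇒n≤o s far)))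
        (m≤n⇒m⊓n≡m (m+m≤n⇒m≤⌊n/2⌋ (m+n≤o⇒m≤o∸n (b + b) (begin
          b + b + s   ≡⟨ +-comm (b + b) s ⟩
          s + (b + b) ≡⟨ +-assoc s b b ⟨
          s + b + b   ≤⟨ +-monoˡ-≤ b far ⟩
          r + b       ∎))))
  where open ≤-Reasoning

-- Here `r ≤ b` and `r + r ≤ r + b ∸ s`, so `r` is the least of the three. In this range the ceiling
-- in `place` vanishes.
area≤b⇒defect≡r : ∀ {b r s} → r + s ≤ b → defect b (r , s) ≡ r
area≤b⇒defect≡r {b} {r} {s} r+s≤b =
  trans (cong (_⊓ ⌊ r + b ∸ s /2⌋) (m≤n⇒m⊓n≡m (m+n≤o⇒m≤o r r+s≤b)))
        (m≤n⇒m⊓n≡m (m+m≤n⇒m≤⌊n/2⌋ (m+n≤o⇒m≤o∸n (r + r) (begin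
          r + r + s   ≡⟨ +-assoc r r s ⟩
          r + (r + s) ≤⟨ +-monoʳ-≤ r r+s≤b ⟩
          r + b       ∎))))
  where open ≤-Reasoning

-- The numbers `r + b ∸ s` and `r + s ∸ b` sum to `r + r`, hence have the same parity, and rounding
-- one half down and the other up cancels.
b≤area⇒halves≡r : ∀ {b r s} → s ≤ r + b → b ≤ r + s →
  ⌊ r + b ∸ s /2⌋ + ⌈ r + s ∸ b /2⌉ ≡ r
b≤area⇒halves≡r {b} {r} {s} s≤r+b b≤r+s =
  ⌊m/2⌋+⌈n/2⌉≡o (r + b ∸ s) (+-cancelʳ-≡ (s + b) _ _ (begin
    d + c + (s + b)   ≡⟨ rearrange₁ d c s b ⟩
    (s + d) + (b + c) ≡⟨ cong₂ _+_ (m+[n∸m]≡n s≤r+b) (m+[n∸m]≡n b≤r+s) ⟩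
    (r + b) + (r + s) ≡⟨ rearrange₂ r b s ⟩
    r + r + (s + b)   ∎))
  where
  open ≡-Reasoning
  d = r + b ∸ s
  c = r + s ∸ b
  rearrange₁ : ∀ d c s b → d + c + (s + b) ≡ (s + d) + (b + c)
  rearrange₁ = solve-∀
  rearrange₂ : ∀ r b s → (r + b) + (r + s) ≡ r + r + (s + b)
  rearrange₂ = solve-∀

-- Recovering a pair from its defect and area.

place : ℕ → ℕ → ℕ → Ranks
place b e A = r , A ∸ r
  -- The truncation is intended: for `A ≤ b` it makes `r` equal to `e`.
  where r = e + ⌈ A ∸ b /2⌉

place-defect-area : ∀ {b x} → proj₂ x ≤ proj₁ x + b → defect b x < b →
  place b (defect b x) (rankArea x) ≡ x
place-defect-area {b} {r , s} s≤r+b e<b =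
  cong₂ _,_ r′≡r (trans (cong (r + s ∸_) r′≡r) (m+n∸m≡n r s))
  where
  h = ⌊ r + b ∸ s /2⌋
  r′≡r : defect b (r , s) + ⌈ r + s ∸ b /2⌉ ≡ r
  r′≡r with ≤-total (r + s) b
  ... | inj₁ r+s≤b = trans (cong₂ _+_ (area≤b⇒defect≡r r+s≤b) (cong ⌈_/2⌉ (m≤n⇒m∸n≡0 r+s≤b)))
                           (+-identityʳ r)
  ... | inj₂ b≤r+s = trans (cong (_+ ⌈ r + s ∸ b /2⌉) e≡h) halves
    where
    halves : h + ⌈ r + s ∸ b /2⌉ ≡ r
    halves = b≤area⇒halves≡r s≤r+b b≤r+s
    h≤r : h ≤ r
    h≤r = m+n≤o⇒m≤o h (≤-reflexive halves)
    h≤b : h ≤ b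
    h≤b with ≤-total h b
    ... | inj₁ h≤b = h≤b
    -- From `b ≤ h ≤ r` the defect would be at least `b`.
    ... | inj₂ b≤h = contradiction (⊓-glb (⊓-glb (≤-trans b≤h h≤r) ≤-refl) b≤h) (<⇒≱ e<b)
    e≡h : defect b (r , s) ≡ h
    e≡h = m≥n⇒m⊓n≡n (⊓-glb h≤r h≤b)

-- Twice the defect is at most `d`, and `d + (r + s)` is `r + r + b`. As area, bounce and defect sum
-- to `a + a + b`, this says that the defect is at most the bounce.
2*defect+area≤ : ∀ {a b x} → Valid a b x → defect b x + defect b x + rankArea x ≤ a + a + b
2*defect+area≤ {a} {b} {r , s} (r≤a , s≤r+b) = begin
  e + e + (r + s)         ≤⟨ +-monoˡ-≤ (r + s) (m≤⌊n/2⌋⇒m+m≤n d (m⊓n≤n (r ⊓ b) _)) ⟩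
  d + (r + s)             ≡⟨ rearrange₁ d r s ⟩
  r + (s + d)             ≡⟨ cong (r +_) (m+[n∸m]≡n s≤r+b) ⟩
  r + (r + b)             ≡⟨ +-assoc r r b ⟨
  r + r + b               ≤⟨ +-monoˡ-≤ b (+-mono-≤ r≤a r≤a) ⟩
  a + a + b               ∎
  where
  open ≤-Reasoning
  e = defect b (r , s)
  d = r + b ∸ s
  rearrange₁ : ∀ d r s → d + (r + s) ≡ r + (s + d)
  rearrange₁ = solve-∀

-- For `A ≤ b` the pair is `(e , A ∸ e)`, valid by `e ≤ a` and `e ≤ A`. For `b ≤ A` the bound on
-- `e + e + A` gives `r ≤ a`, and the sum of the rounded halves gives the defect.
place-correct : ∀ {a b e A} → e ≤ a → e ≤ A → e + e + A ≤ a + a + b → e < b →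
  Valid a b (place b e A) × rankArea (place b e A) ≡ A × defect b (place b e A) ≡ e
place-correct {a} {b} {e} {A} e≤a e≤A 2e+A≤N e<b with ≤-total A b
... | inj₁ A≤b rewrite m≤n⇒m∸n≡0 A≤b | +-identityʳ e =
  (e≤a , ≤-trans (m∸n≤m A e) (≤-trans A≤b (m≤n+m b e))) ,
  m+[n∸m]≡n e≤A ,
  area≤b⇒defect≡r (subst (_≤ b) (sym (m+[n∸m]≡n e≤A)) A≤b)
... | inj₂ b≤A = (r≤a , s≤r+b) , area≡A , defect≡e
  where
  open ≤-Reasoning
  c = A ∸ b
  r = e + ⌈ c /2⌉
  s = A ∸ r

  2e+c≤2a : e + e + c ≤ a + a
  2e+c≤2a = +-cancelʳ-≤ b (e + e + c) (a + a) (begin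
    e + e + c + b   ≡⟨ +-assoc (e + e) c b ⟩
    e + e + (c + b) ≡⟨ cong (e + e +_) (m∸n+n≡m b≤A) ⟩
    e + e + A       ≤⟨ 2e+A≤N ⟩
    a + a + b       ∎)

  -- `r` is `⌈ e + e + c /2⌉`, so it is enough to halve `2e+c≤2a`.
  r≤a : r ≤ a
  r≤a = begin
    e + ⌈ c /2⌉     ≡⟨ ⌈m+m+n/2⌉≡m+⌈n/2⌉ e c ⟨
    ⌈ e + e + c /2⌉ ≤⟨ ⌈n/2⌉-mono 2e+c≤2a ⟩
    ⌈ a + a /2⌉     ≡⟨ n≡⌈n+n/2⌉ a ⟨
    a               ∎

  area≡A : r + s ≡ A
  area≡A = m+[n∸m]≡n (begin
    e + ⌈ c /2⌉ ≤⟨ +-mono-≤ (<⇒≤ e<b) (⌈n/2⌉≤n c) ⟩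
    b + c       ≡⟨ m+[n∸m]≡n b≤A ⟩
    A           ∎)

  -- Since `r + s` is `A`, this means `A ≤ r + r + b`, and `c` is at most twice its half rounded up.
  s≤r+b : s ≤ r + b
  s≤r+b = +-cancelˡ-≤ r s (r + b) (begin
    r + s                     ≡⟨ area≡A ⟩
    A                         ≡⟨ m∸n+n≡m b≤A ⟨
    c + b                     ≤⟨ +-monoˡ-≤ b (n≤⌈n/2⌉+⌈n/2⌉ c) ⟩
    ⌈ c /2⌉ + ⌈ c /2⌉ + b     ≤⟨ +-monoˡ-≤ b (+-mono-≤ (m≤n+m _ e) (m≤n+m _ e)) ⟩
    r + r + b                 ≡⟨ +-assoc r r b ⟩
    r + (r + b)               ∎)

  -- The rounded halves sum to `r`, which is `e + ⌈ c /2⌉` by construction.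
  h≡e : ⌊ r + b ∸ s /2⌋ ≡ e
  h≡e = +-cancelʳ-≡ ⌈ c /2⌉ _ _
    (subst (λ x → ⌊ r + b ∸ s /2⌋ + ⌈ x ∸ b /2⌉ ≡ r) area≡A
      (b≤area⇒halves≡r s≤r+b (subst (b ≤_) (sym area≡A) b≤A)))

  defect≡e : r ⊓ b ⊓ ⌊ r + b ∸ s /2⌋ ≡ e
  defect≡e = trans (cong (r ⊓ b ⊓_) h≡e) (m≥n⇒m⊓n≡n (⊓-glb (m≤m+n e _) (<⇒≤ e<b)))

-- The involution exchanging area and bounce.

mirror : ℕ → ℕ → Ranks → Ranks
mirror a b (r , s) =
  if does (s + b ≤? r)
  then (a ∸ s , a ∸ r)
  else place b (defect b (r , s)) (rankBounce a b (r , s))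

mirror-far : ∀ {a b r s} → s + b ≤ r → mirror a b (r , s) ≡ (a ∸ s , a ∸ r)
mirror-far {a} {b} {r} {s} far =
  if-elim (_≡ (a ∸ s , a ∸ r)) (s + b ≤? r) (λ _ → refl) (contradiction far)

mirror-near : ∀ {a b} x → defect b x < b →
  mirror a b x ≡ place b (defect b x) (rankBounce a b x)
mirror-near {a} {b} x@(r , s) e<b =
  if-elim (_≡ place b (defect b x) (rankBounce a b x)) (s + b ≤? r)
    (λ far → contradiction (far⇒defect≡b {b} {r} {s} far) (<⇒≢ e<b)) (λ _ → refl)

record Mirrored (a b : ℕ) (x : Ranks) : Set where
  field
    valid      : Valid a b (mirror a b x)
    area≡      : rankArea (mirror a b x) ≡ rankBounce a b x
    bounce≡    : rankBounce a b (mirror a b x) ≡ rankArea x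
    involutive : mirror a b (mirror a b x) ≡ x
open Mirrored

-- The new pair has the same difference of ranks, so it is far as well. Far pairs have defect `b`,
-- so area and bounce sum to `a + a`, and so do the old and the new area.
mirrored-far : ∀ {a b r s} → Valid a b (r , s) → s + b ≤ r → Mirrored a b (r , s)
mirrored-far {a} {b} {r} {s} v@(r≤a , s≤r+b) far = record
  { valid      = subst (Valid a b) (sym eq) v′
  ; area≡      = trans (cong rankArea eq) (+-cancelʳ-≡ (r + s) _ _ (trans A′+A≡2a (sym B+A≡2a)))
  ; bounce≡    = trans (cong (rankBounce a b) eq) (+-cancelˡ-≡ (a ∸ s + (a ∸ r)) _ _
                   (trans (A+B≡2a v′ far′) (sym A′+A≡2a)))
  ; involutive = trans (cong (mirror a b) eq)
                   (trans (mirror-far far′) (cong₂ _,_ (m∸[m∸n]≡n r≤a) (m∸[m∸n]≡n s≤a)))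
  }
  where
  s≤r : s ≤ r
  s≤r = m+n≤o⇒m≤o s far

  s≤a : s ≤ a
  s≤a = ≤-trans s≤r r≤a

  eq : mirror a b (r , s) ≡ (a ∸ s , a ∸ r)
  eq = mirror-far far

  v′ : Valid a b (a ∸ s , a ∸ r)
  v′ = m∸n≤m a s , ≤-trans (∸-monoʳ-≤ a s≤r) (m≤m+n (a ∸ s) b)

  far′ : a ∸ r + b ≤ a ∸ s
  far′ = m+n≤o⇒m≤o∸n (a ∸ r + b) (let open ≤-Reasoning in begin
    a ∸ r + b + s   ≡⟨ +-assoc (a ∸ r) b s ⟩
    a ∸ r + (b + s) ≡⟨ cong (a ∸ r +_) (+-comm b s) ⟩
    a ∸ r + (s + b) ≤⟨ +-monoʳ-≤ (a ∸ r) far ⟩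
    a ∸ r + r       ≡⟨ m∸n+n≡m r≤a ⟩
    a               ∎)

  A+B≡2a : ∀ {x} → Valid a b x → proj₂ x + b ≤ proj₁ x → rankArea x + rankBounce a b x ≡ a + a
  A+B≡2a {x} v far = +-cancelʳ-≡ b _ _
    (trans (cong (rankArea x + rankBounce a b x +_) (sym (far⇒defect≡b {b} {proj₁ x} {proj₂ x} far)))
           (area+bounce+defect a b v))

  B+A≡2a : rankBounce a b (r , s) + (r + s) ≡ a + a
  B+A≡2a = trans (+-comm _ (r + s)) (A+B≡2a v far)

  A′+A≡2a : a ∸ s + (a ∸ r) + (r + s) ≡ a + a
  A′+A≡2a = begin
    a ∸ s + (a ∸ r) + (r + s)     ≡⟨ rearrange (a ∸ s) (a ∸ r) r s ⟩
    (s + (a ∸ s)) + (r + (a ∸ r)) ≡⟨ cong₂ _+_ (m+[n∸m]≡n s≤a) (m+[n∸m]≡n r≤a) ⟩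
    a + a                         ∎
    where
    open ≡-Reasoning
    rearrange : ∀ x y r s → x + y + (r + s) ≡ (s + x) + (r + y)
    rearrange = solve-∀

-- `place` keeps the defect and turns the old bounce into the area; the sum of area, bounce and
-- defect being fixed, the new bounce is the old area. A second application rebuilds `x` from its
-- own defect and area.
mirrored-near : ∀ {a b x} → Valid a b x → defect b x < b → Mirrored a b x
mirrored-near {a} {b} {x} v@(r≤a , s≤r+b) e<b =
  helper (place-correct (≤-trans e≤r r≤a) e≤B 2e+B≤N e<b)
  where
  e = defect b x
  A = rankArea x
  B = rankBounce a b x
  y = place b e B
  open ≤-Reasoning

  A+B+e≡N : A + B + e ≡ a + a + b
  A+B+e≡N = area+bounce+defect a b v

  e≤r : e ≤ proj₁ x
  e≤r = ≤-trans (m⊓n≤m _ _) (m⊓n≤m _ _)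

  -- This is `2*defect+area≤` with `a + a + b` written as `A + B + e`. In the same way `2e+B≤N`
  -- below comes from `e ≤ A`.
  e≤B : e ≤ B
  e≤B = +-cancelʳ-≤ (A + e) e B (begin
    e + (A + e) ≡⟨ rearrange₁ e A ⟩
    e + e + A   ≤⟨ 2*defect+area≤ v ⟩
    a + a + b   ≡⟨ A+B+e≡N ⟨
    A + B + e   ≡⟨ rearrange₂ A B e ⟩
    B + (A + e) ∎)
    where
    rearrange₁ : ∀ e A → e + (A + e) ≡ e + e + A
    rearrange₁ = solve-∀
    rearrange₂ : ∀ A B e → A + B + e ≡ B + (A + e)
    rearrange₂ = solve-∀

  2e+B≤N : e + e + B ≤ a + a + b
  2e+B≤N = begin
    e + e + B   ≡⟨ rearrange e B ⟩
    e + B + e   ≤⟨ +-monoˡ-≤ e (+-monoˡ-≤ B (≤-trans e≤r (m≤m+n _ _))) ⟩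
    A + B + e   ≡⟨ A+B+e≡N ⟩
    a + a + b   ∎
    where
    rearrange : ∀ e B → e + e + B ≡ e + B + e
    rearrange = solve-∀

  eq : mirror a b x ≡ y
  eq = mirror-near x e<b

  helper : Valid a b y × rankArea y ≡ B × defect b y ≡ e → Mirrored a b x
  helper (vy , Ay≡B , ey≡e) = record
    { valid      = subst (Valid a b) (sym eq) vy
    ; area≡      = trans (cong rankArea eq) Ay≡B
    ; bounce≡    = trans (cong (rankBounce a b) eq) By≡A
    ; involutive = trans (cong (mirror a b) eq) (trans (mirror-near y (subst (_< b) (sym ey≡e) e<b))
                     (trans (cong₂ (place b) ey≡e By≡A) (place-defect-area s≤r+b e<b)))
    }
    where
    By≡A : rankBounce a b y ≡ A
    By≡A = +-cancelˡ-≡ B _ _ (+-cancelʳ-≡ e _ _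
      (trans (cong₂ (λ u w → u + rankBounce a b y + w) (sym Ay≡B) (sym ey≡e))
        (trans (area+bounce+defect a b vy)
          (trans (sym A+B+e≡N) (cong (_+ e) (+-comm A B))))))

mirrored : ∀ {a b} x → Valid a b x → Mirrored a b x
mirrored {b = b} x v with b ≤? defect b x
... | yes b≤e = mirrored-far v (b≤defect⇒far (proj₂ v) b≤e)
... | no  b≰e = mirrored-near v (≰⇒> b≰e)

-- Dyck paths as valid rank pairs.

private
  variable
    n h k k₁ k₂ k₃ : ℕ
    ks : Vec ℕ n

-- Blue steps before the first red one only lower the level, hence `r ≤ h`. The rest `p′` starts
-- after that red step, so iterating bounds the ranks one by one.
redRanks-split : (p : Path (k ∷ ks) h) →
  ∃[ r ] r ≤ h × Σ[ p′ ∈ Path ks (r + k) ] redRanks p ≡ r ∷ redRanks p′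
redRanks-split (red p)  = _ , ≤-refl , p , refl
redRanks-split (blue p) with r , r≤h , p′ , eq ← redRanks-split p = r , m≤n⇒m≤1+n r≤h , p′ , eq

-- The first rank is `suc h` on the left and at most `h` on the right. Hence the ranks determine
-- whether the next step is red or blue.
redRanks-red≢blue : ∀ {p : Path ks (suc h + k)} {p′ : Path (k ∷ ks) h} →
  redRanks (red p) ≢ redRanks (blue p′)
redRanks-red≢blue {p′ = p′} eq with r , r≤h , _ , eq′ ← redRanks-split p′ =
  1+n≰n (≤-trans (≤-reflexive (∷-injectiveˡ (trans eq eq′))) r≤h)

redRanks-injective : ∀ {p p′ : Path ks h} → redRanks p ≡ redRanks p′ → p ≡ p′
redRanks-injective {p = end}    {end}     eq = refl
redRanks-injective {p = red p}  {red p′}  eq = cong red (redRanks-injective (∷-injectiveʳ eq))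
redRanks-injective {p = blue p} {blue p′} eq = cong blue (redRanks-injective eq)
redRanks-injective {p = red p}  {blue p′} eq = contradiction eq (redRanks-red≢blue {p = p} {p′})
redRanks-injective {p = blue p} {red p′}  eq = contradiction (sym eq) (redRanks-red≢blue {p = p′} {p})

-- A proof by `_≤′_` has one `≤′-step` for each blue step to be added.
prepend-blues : ∀ {r} → r ≤′ h → (p : Path ks r) → Σ[ p′ ∈ Path ks h ] redRanks p′ ≡ redRanks p
prepend-blues ≤′-refl       p = p , refl
prepend-blues (≤′-step r≤h) p with p′ , eq ← prepend-blues r≤h p = blue p′ , eq

lastTwo : Vec ℕ 3 → Ranks
lastTwo (_ ∷ r₂ ∷ r₃ ∷ []) = r₂ , r₃

ranks : {ks : Vec ℕ 3} → DyckPath ks → Ranks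
ranks D = lastTwo (redRanks D)

-- `lastTwo` loses nothing, since a Dyck path starts with a red step of rank 0.
ranks-injective : ∀ {D D′ : DyckPath (k₁ ∷ k₂ ∷ k₃ ∷ [])} → ranks D ≡ ranks D′ → D ≡ D′
ranks-injective {D = red p} {red p′} eq = cong red (redRanks-injective (lastTwo-injective eq))
  where
  lastTwo-injective : ∀ {u v : Vec ℕ 2} → lastTwo (0 ∷ u) ≡ lastTwo (0 ∷ v) → u ≡ v
  lastTwo-injective {_ ∷ _ ∷ []} {_ ∷ _ ∷ []} refl = refl

ranks-valid : (D : DyckPath (k₁ ∷ k₂ ∷ k₃ ∷ [])) → Valid k₁ k₂ (ranks D)
ranks-valid {k₁} {k₂} (red p)
  with r₂ , r₂≤k₁ , p₂ , eq₂ ← redRanks-split p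
  with r₃ , r₃≤r₂+k₂ , p₃ , eq₃ ← redRanks-split p₂
  -- No red step is left; matching on `[]` lets `lastTwo` compute.
  with [] ← redRanks p₃
  = subst (Valid k₁ k₂ ∘ lastTwo) (sym (cong (0 ∷_) (trans eq₂ (cong (r₂ ∷_) eq₃)))) (r₂≤k₁ , r₃≤r₂+k₂)

-- The path is built from its end: each red step is put in front, then the blue steps leading down
-- to its start.
ranks-surjective : ∀ {x} → Valid k₁ k₂ x → ∃[ D ] ranks {k₁ ∷ k₂ ∷ k₃ ∷ []} D ≡ x
ranks-surjective {k₃ = k₃} {r₂ , r₃} (r₂≤k₁ , r₃≤r₂+k₂)
  with p₁ , _ ← prepend-blues (z≤′n {r₃ + k₃}) end
  with p₂ , eq₂ ← prepend-blues (≤⇒≤′ r₃≤r₂+k₂) (red p₁)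
  with p₃ , eq₃ ← prepend-blues (≤⇒≤′ r₂≤k₁) (red p₂)
  with [] ← redRanks p₁
  = red p₃ , cong (lastTwo ∘ (0 ∷_)) (trans eq₃ (cong (r₂ ∷_) eq₂))

area≡rankArea : {ks : Vec ℕ 3} (D : DyckPath ks) → area D ≡ rankArea (ranks D)
area≡rankArea D with redRanks D
... | _ ∷ _ ∷ _ ∷ [] = refl

bounce≡rankBounce : (D : DyckPath (k₁ ∷ k₂ ∷ k₃ ∷ [])) → bounce D ≡ rankBounce k₁ k₂ (ranks D)
bounce≡rankBounce D with redRanks D
... | _ ∷ _ ∷ _ ∷ [] = refl

-- Permutations of terms and coefficients.

involution-↭ : ∀ {A : Set} {xs : List A} (f : A → A) → Unique xs →
  (∀ {x} → x ∈ xs → f x ∈ xs) → (∀ {x} → x ∈ xs → f (f x) ≡ x) → xs ↭ map f xs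
involution-↭ {xs = xs} f xs! closed invol = ∼bag⇒↭ (unique∧set⇒bag xs! fxs! (mk⇔ to from))
  where
  to : ∀ {x} → x ∈ xs → x ∈ map f xs
  to x∈xs = subst (_∈ map f xs) (invol x∈xs) (∈-map⁺ f (closed x∈xs))
  from : ∀ {x} → x ∈ map f xs → x ∈ xs
  from x∈fxs with y , y∈xs , refl ← ∈-map⁻ f x∈fxs = closed y∈xs
  -- `f` is injective only on `xs`, so uniqueness of `map f xs` is pulled back from its image under
  -- `map f`, which is `xs` again.
  map-map : map f (map f xs) ≡ xs
  map-map = trans (sym (map-∘ xs)) (trans (map-cong-local (All.tabulate invol)) (map-id xs))
  fxs! : Unique (map f xs)
  fxs! = Uniqueₚ.map⁻ (subst Unique (sym map-map) xs!)

coeff-↭ : ∀ {f g} → f ↭ g → f ≈ g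
coeff-↭ _↭_.refl m = refl
coeff-↭ (prep (c , m′) f↭g) m =
  cong ((if does (≡-dec _≟_ _≟_ m′ m) then c else 0) +_) (coeff-↭ f↭g m)
coeff-↭ (swap {f} {g} (c , m′) (c′ , m″) f↭g) m = begin
  x + (y + coeff f m) ≡⟨ +-assoc x y _ ⟨
  x + y + coeff f m   ≡⟨ cong₂ _+_ (+-comm x y) (coeff-↭ f↭g m) ⟩
  y + x + coeff g m   ≡⟨ +-assoc y x _ ⟩
  y + (x + coeff g m) ∎
  where
  open ≡-Reasoning
  x = if does (≡-dec _≟_ _≟_ m′ m) then c else 0
  y = if does (≡-dec _≟_ _≟_ m″ m) then c′ else 0
coeff-↭ (_↭_.trans f↭g g↭h) m = trans (coeff-↭ f↭g m) (coeff-↭ g↭h m)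

q↑n : ∀ n → q ↑ n ≡ [ 1 , n , 0 ]
q↑n zero    = refl
q↑n (suc n) = cong (q ⊗_) (q↑n n)

t↑n : ∀ n → t ↑ n ≡ [ 1 , 0 , n ]
t↑n zero    = refl
t↑n (suc n) = cong (t ⊗_) (t↑n n)

qᵐ⊗tⁿ : ∀ m n → q ↑ m ⊗ t ↑ n ≡ [ 1 , m , n ]
qᵐ⊗tⁿ m n = trans (cong₂ _⊗_ (q↑n m) (t↑n n)) (cong (λ i → [ 1 , i , n ]) (+-identityʳ m))

tᵐ⊗qⁿ : ∀ m n → t ↑ m ⊗ q ↑ n ≡ [ 1 , n , m ]
tᵐ⊗qⁿ m n = trans (cong₂ _⊗_ (t↑n m) (q↑n n)) (cong (λ j → [ 1 , n , j ]) (+-identityʳ m))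

-- Every summand is a single monomial, so the equality holds for the lists of terms and not only up
-- to `_≈_`. Factoring through `ρ` exposes the list of rank pairs to be permuted.
sumPoly-map : ∀ {A B : Set} (ρ : A → B) (term : A → Poly) (mono : B → ℕ × ℕ × ℕ) →
  (∀ x → term x ≡ [ mono (ρ x) ]) → ∀ xs → sumPoly (map term xs) ≡ map mono (map ρ xs)
sumPoly-map ρ term mono eq []       = refl
sumPoly-map ρ term mono eq (x ∷ xs) = cong₂ _++_ (eq x) (sumPoly-map ρ term mono eq xs)

theorem1 : (k₁ k₂ k₃ : ℕ) .{{_ : NonZero k₁}} .{{_ : NonZero k₂}} .{{_ : NonZero k₃}} →
    C (k₁ ∷ k₂ ∷ k₃ ∷ []) q t ≈ C (k₁ ∷ k₂ ∷ k₃ ∷ []) t q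
theorem1 k₁ k₂ k₃ m = begin
  coeff (C heights q t) m
    ≡⟨ cong (λ f → coeff f m) (sumPoly-map ranks _ mono Cqt-term Ds) ⟩
  coeff (map mono L) m
    -- `mirror` permutes `L`, so this only reorders the terms.
    ≡⟨ coeff-↭ (map⁺ mono L↭mirrorL) m ⟩
  coeff (map mono (map (mirror k₁ k₂) L)) m
    -- At the mirrored pair the two exponents have traded places.
    ≡⟨ cong (λ f → coeff f m) mono-mirror ⟩
  coeff (map onom L) m
    ≡⟨ cong (λ f → coeff f m) (sumPoly-map ranks _ onom Ctq-term Ds) ⟨
  coeff (C heights t q) m
    ∎
  where
  open ≡-Reasoning

  heights = k₁ ∷ k₂ ∷ k₃ ∷ []
  Ds = dyckPaths heights
  L = map ranks Ds

  mono onom : Ranks → ℕ × ℕ × ℕ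
  mono x = 1 , rankArea x , rankBounce k₁ k₂ x
  onom x = 1 , rankBounce k₁ k₂ x , rankArea x

  Cqt-term : ∀ D → q ↑ area {heights} D ⊗ t ↑ bounce D ≡ [ mono (ranks D) ]
  Cqt-term D = trans (qᵐ⊗tⁿ (area D) (bounce D))
    (cong₂ (λ i j → [ 1 , i , j ]) (area≡rankArea D) (bounce≡rankBounce D))

  Ctq-term : ∀ D → t ↑ area {heights} D ⊗ q ↑ bounce D ≡ [ onom (ranks D) ]
  Ctq-term D = trans (tᵐ⊗qⁿ (area D) (bounce D))
    (cong₂ (λ i j → [ 1 , j , i ]) (area≡rankArea D) (bounce≡rankBounce D))

  L-mirrored : ∀ {x} → x ∈ L → Mirrored k₁ k₂ x
  L-mirrored x∈L with D , _ , refl ← ∈-map⁻ ranks x∈L = mirrored (ranks D) (ranks-valid D)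

  valid⇒∈L : ∀ {x} → Valid k₁ k₂ x → x ∈ L
  valid⇒∈L v with D , refl ← ranks-surjective {k₃ = k₃} v = ∈-map⁺ ranks (paths-complete D)

  L↭mirrorL : L ↭ map (mirror k₁ k₂) L
  L↭mirrorL = involution-↭ (mirror k₁ k₂) (Uniqueₚ.map⁺ ranks-injective (paths-unique heights 0))
    (λ x∈L → valid⇒∈L (valid (L-mirrored x∈L))) (λ x∈L → involutive (L-mirrored x∈L))

  mono-mirror : map mono (map (mirror k₁ k₂) L) ≡ map onom L
  mono-mirror = trans (sym (map-∘ L)) (map-cong-local (All.tabulate λ x∈L →
    cong₂ (λ i j → 1 , i , j) (area≡ (L-mirrored x∈L)) (bounce≡ (L-mirrored x∈L))))
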